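{- For every positive integer $n$ and every $I\subseteq[n-1]$, $$|\{\pi\in\mathcal{C}_{n+1} : D(\pi)\cap[n-1]=I\}|=|\{\sigma\in\mathcal{S}_n : D(\sigma)=I\}|.$$
   Context: $[n]=\{1,2,\dots,n\}$; $\mathcal{S}_n$ is the set of permutations of $[n]$; $\mathcal{C}_n\subseteq\mathcal{S}_n$ is the set of permutations consisting of one single cycle of length $n$. For $\pi\in\mathcal{S}_n$, $D(\pi)=\{i : 1\le i\le n-1,\ \pi(i)>\pi(i+1)\}$. -}

module Defs where

open import Data.Fin using (Fin; suc; toℕ; inject₁)
open import Data.Fin.Permutation using (Permutation′; _⟨$⟩ʳ_; _≈_)
open import Data.Fin.Properties using (_<?_)
open import Data.Fin.Subset using (Subset; outside)
open import Data.Nat using (ℕ; NonZero)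
open import Data.Nat.DivMod using (_mod_)
open import Data.Product using (Σ; proj₁)
open import Data.Vec using (tabulate; _∷ʳ_)
open import Function.Bundles using (Inverse)
open import Level using (0ℓ)
open import Relation.Binary.Bundles using (Setoid)
import Relation.Binary.Construct.On as On
open import Relation.Binary.PropositionalEquality
  using (_≡_; refl; sym; trans; setoid)
open import Relation.Nullary using (does)

-- Throughout, the element i of [n] = {1, …, n} is represented by the element
-- of Fin n whose toℕ is i − 1.

-- Elements of Permutation′ n carry inverse-law proofs, so the set Sₙ is the
-- setoid in which permutations are compared by their values.
Sym : ℕ → Setoid 0ℓ 0ℓ
Sym n = record
  { Carrier       = Permutation′ n
  ; _≈_           = _≈_
  ; isEquivalence = record
    { refl  = λ _ → refl
    ; sym   = λ p i → sym (p i)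
    ; trans = λ p q i → trans (p i) (q i)
    }
  }

-- { π ∈ Sₙ : P π }; proofs of P π are ignored by the equality.
Perms : (n : ℕ) → (Permutation′ n → Set) → Setoid 0ℓ 0ℓ
Perms n P = On.setoid {B = Σ (Permutation′ n) P} (Sym n) proj₁

infix 4 _HasSize_

_HasSize_ : Setoid 0ℓ 0ℓ → ℕ → Set
A HasSize k = Inverse A (setoid (Fin k))

next : {n : ℕ} .{{_ : NonZero n}} → Fin n → Fin n
next {n} i = ℕ.suc (toℕ i) mod n

-- In cycle notation π = (c₁ c₂ … cₙ), with c listing every element of [n]
-- exactly once: π sends each entry to the cyclically following one.
IsCycle : {n : ℕ} .{{_ : NonZero n}} → Permutation′ n → Set
IsCycle {n} π =
  Σ (Permutation′ n) λ c → ∀ i → π ⟨$⟩ʳ (c ⟨$⟩ʳ i) ≡ c ⟨$⟩ʳ next i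

-- For π ∈ Sₘ₊₁ the descent set is a subset of [m]. Position i ∈ [m] is
-- inject₁ i and position i + 1 is suc i when regarded as elements of [m + 1].
D : {m : ℕ} → Permutation′ (ℕ.suc m) → Subset m
D π = tabulate λ i → does (π ⟨$⟩ʳ suc i <? π ⟨$⟩ʳ inject₁ i)

-- A subset of [m] regarded as a subset of [m + 1] (not containing m + 1).
ι : {m : ℕ} → Subset m → Subset (ℕ.suc m)
ι I = I ∷ʳ outside

{-# OPTIONS --safe #-}

-- Let b label each position by the number of elements of I before it, and give
-- the last position n + 1 a label ∞ of its own. Permutations σ ∈ Sₙ with
-- D(σ) ⊆ I are the inverses of the stable sortings of the words w with the
-- letters b(1), …, b(n). Cycles π ∈ Cₙ₊₁ with D(π) ∩ [n − 1] ⊆ I are in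
-- bijection with the same words (Gessel–Reutenauer): reading b backwards along
-- the cycle from n + 1 spells ∞w, and conversely the cycle is recovered because
-- the entries are ordered as the reversed prefixes of ∞w are lexicographically;
-- these are distinct as ∞ occurs only once. So the two statistics have the
-- same cumulative counts for every I, and Möbius inversion over the subsets of
-- [n − 1] gives the claim.
module Submission where

open import Defs
open import Algebra.Properties.CommutativeSemigroup using (interchange)
open import Data.Bool using (Bool)
import Data.Bool.Properties as Bool
open import Data.Fin using (Fin; zero; suc; toℕ; fromℕ; fromℕ<; inject₁; punchIn; combine; finToFun; funToFin)
open import Data.Fin.Induction using (<-weakInduction)
open import Data.Fin.Permutation
  using (Permutation′; permutation; _⟨$⟩ʳ_; _⟨$⟩ˡ_; _≈_; inverseˡ; inverseʳ; flip; _∘ₚ_;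
         insert; remove; insert-punchIn; punchIn-permute; ↔⇒≡)
import Data.Fin.Properties as Fin
open import Data.Fin.Relation.Unary.Top using (view; ‵fromℕ; ‵inject₁)
open import Data.Fin.Subset using (Subset; inside; outside; ∣_∣; _∈_; _⊆_; _⊂_; _∩_; ⊤)
import Data.Fin.Subset.Properties as Subset
open import Data.Fin.Subset.Properties using (_⊆?_; ⊆⊤)
open import Data.Nat using (ℕ; zero; suc; _+_; _∸_; _^_; _≤_; _<_; z≤n; s≤s)
open import Data.Nat.DivMod using (_%_; _mod_; %-distribˡ-+; m%n%n≡m%n; m<n⇒m%n≡m; [m+n]%n≡m%n; m%n<n)
import Data.Nat.Properties as ℕ
open import Data.Nat.Solver using (module +-*-Solver)
open import Data.Product using (Σ; ∃-syntax; _×_; _,_; proj₁; proj₂)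
open import Data.Sum using (_⊎_; inj₁; inj₂)
open import Data.Vec using ([]; _∷_; _∷ʳ_; tabulate; lookup; here; there)
open import Data.Vec.Properties
  using (≡-dec; ∷ʳ-injectiveˡ; lookup∘tabulate; tabulate-cong; lookup⇒[]=; []=⇒lookup)
open import Function using (_∘_; Injective; Inverse)
open import Function.Properties.Inverse using () renaming (refl to ≅-refl; sym to ≅-sym; trans to ≅-trans)
open import Level using (0ℓ)
open import Relation.Binary.Bundles using (Setoid)
import Relation.Binary.Construct.On as On
open import Relation.Binary.Core using (Rel)
open import Relation.Binary.Definitions using (DecidableEquality; tri<; tri≈; tri>)
open import Relation.Binary.PropositionalEquality
open import Relation.Nullary using (¬_; Dec; yes; no; does; contradiction)
open import Relation.Nullary.Decidable using (map′; _→-dec_; dec-true)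
open import Relation.Unary using (Decidable)

private variable
  m n M N : ℕ

-- Monotone rearrangements and sorting

Monotone : (Fin N → ℕ) → Set
Monotone f = ∀ {i j} → toℕ i ≤ toℕ j → f i ≤ f j

⟨$⟩ʳ-injective : (π : Permutation′ N) → Injective _≡_ _≡_ (π ⟨$⟩ʳ_)
⟨$⟩ʳ-injective π {i} {j} eq = begin
  i                    ≡⟨ inverseˡ π ⟨
  π ⟨$⟩ˡ (π ⟨$⟩ʳ i)    ≡⟨ cong (π ⟨$⟩ˡ_) eq ⟩
  π ⟨$⟩ˡ (π ⟨$⟩ʳ j)    ≡⟨ inverseˡ π ⟩
  j                    ∎
  where open ≡-Reasoning

-- An injection sends some j ≤ i to a position ≥ i.
monotone-≤ : {f : Fin N → ℕ} {ρ : Fin N → Fin N} → Monotone f →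
             Injective _≡_ _≡_ ρ → Monotone (f ∘ ρ) → ∀ i → f i ≤ f (ρ i)
monotone-≤ f↗ ρ-inj fρ↗ i with Fin.injective⇒existsPivot ρ-inj i
... | _ , j≤i , i≤ρj = ℕ.≤-trans (f↗ i≤ρj) (fρ↗ j≤i)

-- Sorting a word has only one outcome. One inequality is `monotone-≤` for `f` and `ρ`, the other is
-- `monotone-≤` for `f ∘ ρ` and the inverse of `ρ`.
monotone-rearrangement : {f : Fin N → ℕ} (ρ : Permutation′ N) → Monotone f →
                         Monotone (f ∘ (ρ ⟨$⟩ʳ_)) → ∀ i → f (ρ ⟨$⟩ʳ i) ≡ f i
monotone-rearrangement {f = f} ρ f↗ fρ↗ i = ℕ.≤-antisym
  (subst (λ j → f (ρ ⟨$⟩ʳ i) ≤ f j) (inverseʳ ρ)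
    (monotone-≤ fρ↗ (⟨$⟩ʳ-injective (flip ρ))
      (λ {i} {j} i≤j → subst₂ _≤_ (cong f (sym (inverseʳ ρ))) (cong f (sym (inverseʳ ρ))) (f↗ i≤j))
      i))
  (monotone-≤ f↗ (⟨$⟩ʳ-injective ρ) fρ↗ i)

monotone⇒id : (ρ : Permutation′ N) → Monotone (toℕ ∘ (ρ ⟨$⟩ʳ_)) → ∀ i → ρ ⟨$⟩ʳ i ≡ i
monotone⇒id ρ ρ↗ i = Fin.toℕ-injective (monotone-rearrangement ρ (λ i≤j → i≤j) ρ↗ i)

-- Pigeonhole: a value `y` missed by `f` could be put in front of the values of `f`, which would
-- inject `suc N` elements into `N`.
fromInjective : (f : Fin N → Fin N) → Injective _≡_ _≡_ f → Permutation′ N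
fromInjective {N} f f-inj = permutation f (proj₁ ∘ surj) (proj₂ ∘ surj)
  (λ i → f-inj (proj₂ (surj (f i))))
  where
  surj : ∀ y → ∃[ x ] f x ≡ y
  surj y with Fin.any? (λ x → f x Fin.≟ y)
  ... | yes p = p
  ... | no ∄x = contradiction (Fin.injective⇒≤ extended-inj) ℕ.1+n≰n
    where
    extended : Fin (suc N) → Fin N
    extended zero    = y
    extended (suc x) = f x
    extended-inj : Injective _≡_ _≡_ extended
    extended-inj {zero}  {zero}  _  = refl
    extended-inj {zero}  {suc j} eq = contradiction (j , sym eq) ∄x
    extended-inj {suc i} {zero}  eq = contradiction (i , eq) ∄x
    extended-inj {suc i} {suc j} eq = cong suc (f-inj eq)

comprehension : {P : Fin N → Set} → Decidable P → Subset N
comprehension P? = tabulate (does ∘ P?)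

∈-comprehension⁺ : {P : Fin N → Set} (P? : Decidable P) → ∀ {i} → P i → i ∈ comprehension P?
∈-comprehension⁺ P? {i} p = lookup⇒[]= i _ (trans (lookup∘tabulate _ i) (dec-true (P? i) p))

∈-comprehension⁻ : {P : Fin N → Set} (P? : Decidable P) → ∀ {i} → i ∈ comprehension P? → P i
∈-comprehension⁻ P? {i} i∈ with P? i | trans (sym (lookup∘tabulate (does ∘ P?) i)) ([]=⇒lookup i∈)
... | yes p | _ = p

module Sorting
  (_≺_ : Rel (Fin N) 0ℓ)
  (≺-trans : ∀ {i j k} → i ≺ j → j ≺ k → i ≺ k)
  (≺-irrefl : ∀ {i} → ¬ (i ≺ i))
  (≺-connex : ∀ i j → i ≺ j ⊎ i ≡ j ⊎ j ≺ i)
  where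

  -- Here `e` sends an element to its place; it is the inverse of `e` that lists the elements in
  -- increasing order.
  Sorts : Permutation′ N → Set
  Sorts e = ∀ {i j} → i ≺ j → toℕ (e ⟨$⟩ʳ i) < toℕ (e ⟨$⟩ʳ j)

  reflects : (e : Permutation′ N) → Sorts e →
             ∀ {i j} → toℕ (e ⟨$⟩ʳ i) < toℕ (e ⟨$⟩ʳ j) → i ≺ j
  reflects e e-sorts {i} {j} lt with ≺-connex i j
  ... | inj₁ i≺j         = i≺j
  ... | inj₂ (inj₁ refl) = contradiction lt (ℕ.<-irrefl refl)
  ... | inj₂ (inj₂ j≺i)  = contradiction lt (ℕ.<-asym (e-sorts j≺i))

  inverse-monotone : (e : Permutation′ N) → Sorts e → (f : Fin N → ℕ) →
                     (∀ {i j} → i ≺ j → f i ≤ f j) → Monotone (f ∘ (e ⟨$⟩ˡ_))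
  inverse-monotone e e-sorts f f-mono {p} {q} p≤q with p Fin.≟ q
  ... | yes refl = ℕ.≤-refl
  ... | no p≢q   = f-mono (reflects e e-sorts
    (subst₂ (λ x y → toℕ x < toℕ y) (sym (inverseʳ e)) (sym (inverseʳ e))
      (ℕ.≤∧≢⇒< p≤q (p≢q ∘ Fin.toℕ-injective))))

  -- The places under `e′`, read in the order listed by `e`, form a monotone permutation, which can
  -- only be the identity.
  sorting-unique : (e e′ : Permutation′ N) → Sorts e → Sorts e′ → e ≈ e′
  sorting-unique e e′ e-sorts e′-sorts i = begin
    e ⟨$⟩ʳ i                             ≡⟨ monotone⇒id (flip e ∘ₚ e′) mono (e ⟨$⟩ʳ i) ⟨
    e′ ⟨$⟩ʳ (e ⟨$⟩ˡ (e ⟨$⟩ʳ i))          ≡⟨ cong (e′ ⟨$⟩ʳ_) (inverseˡ e) ⟩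
    e′ ⟨$⟩ʳ i                            ∎
    where
    open ≡-Reasoning
    mono : Monotone (toℕ ∘ (flip e ∘ₚ e′ ⟨$⟩ʳ_))
    mono = inverse-monotone e e-sorts (toℕ ∘ (e′ ⟨$⟩ʳ_)) (ℕ.<⇒≤ ∘ e′-sorts)

  -- Read in the order `≺`, the word `b ∘ ρ` is a weakly increasing rearrangement of `b`, hence `b`
  -- itself. This gives the labels of a sorting permutation without computing its values.
  sorting-rearranges : (e : Permutation′ N) → Sorts e →
    {b : Fin N → ℕ} → Monotone b → (ρ : Permutation′ N) →
    (∀ {i j} → i ≺ j → b (ρ ⟨$⟩ʳ i) ≤ b (ρ ⟨$⟩ʳ j)) →
    ∀ i → b (e ⟨$⟩ʳ i) ≡ b (ρ ⟨$⟩ʳ i)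
  sorting-rearranges e e-sorts {b} b↗ ρ bρ-mono i = begin
    b (e ⟨$⟩ʳ i)                         ≡⟨ monotone-rearrangement (flip e ∘ₚ ρ) b↗
                                              (inverse-monotone e e-sorts (b ∘ (ρ ⟨$⟩ʳ_)) bρ-mono) _ ⟨
    b (ρ ⟨$⟩ʳ (e ⟨$⟩ˡ (e ⟨$⟩ʳ i)))       ≡⟨ cong (b ∘ (ρ ⟨$⟩ʳ_)) (inverseˡ e) ⟩
    b (ρ ⟨$⟩ʳ i)                         ∎
    where open ≡-Reasoning

  _≺?_ : ∀ i j → Dec (i ≺ j)
  i ≺? j with ≺-connex i j
  ... | inj₁ i≺j         = yes i≺j
  ... | inj₂ (inj₁ refl) = no ≺-irrefl
  ... | inj₂ (inj₂ j≺i)  = no λ i≺j → ≺-irrefl (≺-trans i≺j j≺i)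

  below : Fin N → Subset N
  below i = comprehension (_≺? i)

  ∈-below⁺ : ∀ {i j} → j ≺ i → j ∈ below i
  ∈-below⁺ {i} = ∈-comprehension⁺ (_≺? i)

  ∈-below⁻ : ∀ {i j} → j ∈ below i → j ≺ i
  ∈-below⁻ {i} = ∈-comprehension⁻ (_≺? i)

  below-⊂ : ∀ {i j} → i ≺ j → below i ⊂ below j
  below-⊂ {i} i≺j =
      (λ k∈ → ∈-below⁺ (≺-trans (∈-below⁻ k∈) i≺j))
    , i , ∈-below⁺ i≺j , ≺-irrefl ∘ ∈-below⁻

  ∣below∣<N : ∀ i → ∣ below i ∣ < N
  ∣below∣<N i = subst (∣ below i ∣ <_) (Subset.∣⊤∣≡n N)
    (Subset.p⊂q⇒∣p∣<∣q∣ (Subset.⊆⊤ , i , Subset.∈⊤ , ≺-irrefl ∘ ∈-below⁻))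

  rank : Fin N → Fin N
  rank i = fromℕ< (∣below∣<N i)

  rank-mono : ∀ {i j} → i ≺ j → toℕ (rank i) < toℕ (rank j)
  rank-mono i≺j = subst₂ _<_ (sym (Fin.toℕ-fromℕ< _)) (sym (Fin.toℕ-fromℕ< _))
    (Subset.p⊂q⇒∣p∣<∣q∣ (below-⊂ i≺j))

  rank-injective : Injective _≡_ _≡_ rank
  rank-injective {i} {j} eq with ≺-connex i j
  ... | inj₁ i≺j        = contradiction (rank-mono i≺j) (ℕ.<-irrefl (cong toℕ eq))
  ... | inj₂ (inj₁ i≡j) = i≡j
  ... | inj₂ (inj₂ j≺i) = contradiction (rank-mono j≺i) (ℕ.<-irrefl (cong toℕ (sym eq)))

  abstract
    -- Counting predecessors gives the places: a larger element has all predecessors of a smaller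
    -- one, and that one besides.
    sorting-exists : Σ (Permutation′ N) Sorts
    sorting-exists = fromInjective rank rank-injective , rank-mono

-- Cycles

module Modular (n : ℕ) where

  private
    1+n : ℕ
    1+n = suc n

  infix 4 _~_
  -- As a record, unlike as a bare equation of remainders, the relation lets `a` and `b` be inferred
  -- from its type.
  record _~_ (a b : ℕ) : Set where
    constructor mk~
    field eq : a % 1+n ≡ b % 1+n

  ~-trans : ∀ {a b c} → a ~ b → b ~ c → a ~ c
  ~-trans (mk~ p) (mk~ q) = mk~ (trans p q)

  ~-sym : ∀ {a b} → a ~ b → b ~ a
  ~-sym (mk~ p) = mk~ (sym p)

  +-cong~ : ∀ {a b} c → a ~ b → a + c ~ b + c
  +-cong~ {a} {b} c (mk~ p) = mk~ (begin
    (a + c) % 1+n              ≡⟨ %-distribˡ-+ a c 1+n ⟩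
    (a % 1+n + c % 1+n) % 1+n  ≡⟨ cong (λ x → (x + c % 1+n) % 1+n) p ⟩
    (b % 1+n + c % 1+n) % 1+n  ≡⟨ %-distribˡ-+ b c 1+n ⟨
    (b + c) % 1+n              ∎)
    where open ≡-Reasoning

  +-congˡ~ : ∀ {a b} c → a ~ b → c + a ~ c + b
  +-congˡ~ {a} {b} c p = subst₂ _~_ (ℕ.+-comm a c) (ℕ.+-comm b c) (+-cong~ c p)

  +1+n~ : ∀ a → a + 1+n ~ a
  +1+n~ a = mk~ ([m+n]%n≡m%n a 1+n)

  mod~ : ∀ a → toℕ (a mod 1+n) ~ a
  mod~ a = mk~ (trans (cong (_% 1+n) (Fin.toℕ-fromℕ< (m%n<n a 1+n))) (m%n%n≡m%n a 1+n))

  ~⇒≡ : ∀ {i j : Fin 1+n} → toℕ i ~ toℕ j → i ≡ j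
  ~⇒≡ {i} {j} (mk~ p) = Fin.toℕ-injective (begin
    toℕ i        ≡⟨ m<n⇒m%n≡m (Fin.toℕ<n i) ⟨
    toℕ i % 1+n  ≡⟨ p ⟩
    toℕ j % 1+n  ≡⟨ m<n⇒m%n≡m (Fin.toℕ<n j) ⟩
    toℕ j        ∎)
    where open ≡-Reasoning

  -- Adding `n + 1 − t` on both sides completes `t` to a full period, which drops out.
  +-cancel~ : ∀ {a b} (t : Fin 1+n) → a + toℕ t ~ b + toℕ t → a ~ b
  +-cancel~ {a} {b} t p =
    ~-trans (~-sym (drop a)) (~-trans (+-cong~ (1+n ∸ toℕ t) p) (drop b))
    where
    drop : ∀ a → (a + toℕ t) + (1+n ∸ toℕ t) ~ a
    drop a = subst (_~ a)
      (sym (trans (ℕ.+-assoc a (toℕ t) _) (cong (a +_) (ℕ.m+[n∸m]≡n (ℕ.<⇒≤ (Fin.toℕ<n t))))))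
      (+1+n~ a)

  -- t ↦ k − t modulo n + 1
  reflectAt : ℕ → Fin 1+n → Fin 1+n
  reflectAt k t = (k + (1+n ∸ toℕ t)) mod 1+n

  -- By cancellation this congruence characterizes the reflection; the facts below are derived from
  -- it.
  reflectAt-+ : ∀ k t → toℕ (reflectAt k t) + toℕ t ~ k
  reflectAt-+ k t = ~-trans (+-cong~ (toℕ t) (mod~ _)) (subst (_~ k)
    (sym (trans (ℕ.+-assoc k _ _) (cong (k +_) (ℕ.m∸n+n≡m (ℕ.<⇒≤ (Fin.toℕ<n t))))))
    (+1+n~ k))

  reflectAt-involutive : ∀ k t → reflectAt k (reflectAt k t) ≡ t
  reflectAt-involutive k t = ~⇒≡ (+-cancel~ (reflectAt k t)
    (~-trans (reflectAt-+ k (reflectAt k t))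
      (subst (k ~_) (ℕ.+-comm (toℕ (reflectAt k t)) (toℕ t)) (~-sym (reflectAt-+ k t)))))

  reflection : ℕ → Permutation′ 1+n
  reflection k = permutation (reflectAt k) (reflectAt k)
    (reflectAt-involutive k) (reflectAt-involutive k)

  reflectAt-zero : ∀ (k : Fin 1+n) → reflectAt (toℕ k) zero ≡ k
  reflectAt-zero k = ~⇒≡ (subst (_~ toℕ k) (ℕ.+-identityʳ _) (reflectAt-+ (toℕ k) zero))

  next~ : ∀ (i : Fin 1+n) → toℕ (next i) ~ suc (toℕ i)
  next~ i = mod~ _

  next-reflectAt-suc : ∀ k (t : Fin n) → next (reflectAt k (suc t)) ≡ reflectAt k (inject₁ t)
  next-reflectAt-suc k t = ~⇒≡ (+-cancel~ (inject₁ t) (~-trans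
    (+-cong~ _ (next~ _)) (~-trans
    (subst (_~ k) shift (reflectAt-+ k (suc t)))
    (~-sym (reflectAt-+ k (inject₁ t))))))
    where
    shift : toℕ (reflectAt k (suc t)) + suc (toℕ t) ≡ suc (toℕ (reflectAt k (suc t)) + toℕ (inject₁ t))
    shift = trans (ℕ.+-suc _ _) (cong (λ x → suc (toℕ (reflectAt k (suc t)) + x)) (sym (Fin.toℕ-inject₁ t)))

  -- Two reflections compose to a rotation: `k − (0 − i) = k + i`.
  reflectAt-0 : ∀ k i → toℕ (reflectAt k (reflectAt 0 i)) ~ k + toℕ i
  reflectAt-0 k i = +-cancel~ (reflectAt 0 i) (~-trans (reflectAt-+ k (reflectAt 0 i)) (~-sym cancelled))
    where
    cancelled : k + toℕ i + toℕ (reflectAt 0 i) ~ k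
    cancelled = subst (_~ k) rearrange (+-cong~ k (reflectAt-+ 0 i))
      where
      open +-*-Solver
      rearrange : toℕ (reflectAt 0 i) + toℕ i + k ≡ k + toℕ i + toℕ (reflectAt 0 i)
      rearrange = solve 3 (λ r i k → r :+ i :+ k := k :+ i :+ r) refl
        (toℕ (reflectAt 0 i)) (toℕ i) k

  next≡rotation : ∀ i → next i ≡ reflectAt 1 (reflectAt 0 i)
  next≡rotation i = ~⇒≡ (~-trans (next~ i) (~-sym (reflectAt-0 1 i)))

  -- Rotations commute with `next`, so a cycle can be read from any starting point.
  rotation-next : ∀ k i → next (reflectAt k (reflectAt 0 i)) ≡ reflectAt k (reflectAt 0 (next i))
  rotation-next k i = ~⇒≡ (~-trans (next~ _) (~-trans (+-congˡ~ 1 (reflectAt-0 k i))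
    (~-sym (~-trans (reflectAt-0 k (next i))
      (subst (k + toℕ (next i) ~_) (ℕ.+-suc k (toℕ i)) (+-congˡ~ k (next~ i)))))))

open Modular using (reflection; reflectAt-involutive; reflectAt-zero; next-reflectAt-suc;
  next≡rotation; rotation-next)

Traces : Permutation′ (suc n) → Permutation′ (suc n) → Set
Traces π c = ∀ i → π ⟨$⟩ʳ (c ⟨$⟩ʳ i) ≡ c ⟨$⟩ʳ next i

-- e lists the cycle of π backwards, starting at its largest element.
record Unwinds (π e : Permutation′ (suc n)) : Set where
  field
    start  : e ⟨$⟩ʳ zero ≡ fromℕ n
    traces : Traces π (reflection n 0 ∘ₚ e)

  -- The form of `traces` suited to induction: since `e` runs backwards, `π` lowers the index by
  -- one.
  step : ∀ t → π ⟨$⟩ʳ (e ⟨$⟩ʳ suc t) ≡ e ⟨$⟩ʳ inject₁ t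
  step t = begin
    π ⟨$⟩ʳ (e ⟨$⟩ʳ suc t)                        ≡⟨ cong (λ x → π ⟨$⟩ʳ (e ⟨$⟩ʳ x)) (reflectAt-involutive n 0 (suc t)) ⟨
    π ⟨$⟩ʳ (e ⟨$⟩ʳ (ρ (ρ (suc t))))              ≡⟨ traces (ρ (suc t)) ⟩
    e ⟨$⟩ʳ ρ (next (ρ (suc t)))                  ≡⟨ cong (λ x → e ⟨$⟩ʳ ρ x) (next-reflectAt-suc n 0 t) ⟩
    e ⟨$⟩ʳ ρ (ρ (inject₁ t))                     ≡⟨ cong (e ⟨$⟩ʳ_) (reflectAt-involutive n 0 (inject₁ t)) ⟩
    e ⟨$⟩ʳ inject₁ t                             ∎
    where
    open ≡-Reasoning
    ρ = reflection n 0 ⟨$⟩ʳ_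

open Unwinds

abstract
  -- `k` is the index at which the listing `c` reaches the largest element, and the backward listing
  -- is `t ↦ c (k − t)`. Reversed again, it is `c` rotated by `k`, which still traces `π`.
  unwinding : (π : Permutation′ (suc n)) → IsCycle π → ∃[ e ] Unwinds π e
  unwinding {n} π (c , c-traces) = ρₖ ∘ₚ c , record
    { start  = trans (cong (c ⟨$⟩ʳ_) (reflectAt-zero n k)) (inverseʳ c)
    ; traces = λ i → trans (c-traces _) (cong (c ⟨$⟩ʳ_) (rotation-next n (toℕ k) i))
    }
    where
    k : Fin (suc n)
    k = c ⟨$⟩ˡ fromℕ n
    ρₖ : Permutation′ (suc n)
    ρₖ = reflection n (toℕ k)

  -- `π` is the shift `x ↦ x − 1` conjugated by `e`. The shift is the reflection at 1 followed by
  -- the one at 0, so it comes as a permutation.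
  winding : (e : Permutation′ (suc n)) → e ⟨$⟩ʳ zero ≡ fromℕ n → ∃[ π ] Unwinds π e
  winding {n} e e₀ = flip e ∘ₚ reflection n 1 ∘ₚ reflection n 0 ∘ₚ e , record
    { start  = e₀
    ; traces = λ i → cong (λ x → e ⟨$⟩ʳ (reflection n 0 ⟨$⟩ʳ x))
        (trans (cong (reflection n 1 ⟨$⟩ʳ_) (inverseˡ e)) (sym (next≡rotation n i)))
    }

Unwinds⇒IsCycle : {π e : Permutation′ (suc n)} → Unwinds π e → IsCycle π
Unwinds⇒IsCycle {n} {e = e} u = reflection n 0 ∘ₚ e , traces u

-- Both listings start at the largest element, and injectivity of `π` propagates agreement from each
-- entry to the following one.
Unwinds-unique : {π π′ e e′ : Permutation′ (suc n)} → π ≈ π′ →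
                 Unwinds π e → Unwinds π′ e′ → e ≈ e′
Unwinds-unique {π = π} {π′} {e} {e′} π≈π′ u u′ = <-weakInduction _
  (trans (start u) (sym (start u′)))
  λ t eq → ⟨$⟩ʳ-injective π (begin
    π ⟨$⟩ʳ (e ⟨$⟩ʳ suc t)     ≡⟨ step u t ⟩
    e ⟨$⟩ʳ inject₁ t          ≡⟨ eq ⟩
    e′ ⟨$⟩ʳ inject₁ t         ≡⟨ step u′ t ⟨
    π′ ⟨$⟩ʳ (e′ ⟨$⟩ʳ suc t)   ≡⟨ π≈π′ _ ⟨
    π ⟨$⟩ʳ (e′ ⟨$⟩ʳ suc t)    ∎)
  where open ≡-Reasoning

Unwinds-determines : {π π′ e e′ : Permutation′ (suc n)} → e ≈ e′ →
                     Unwinds π e → Unwinds π′ e′ → π ≈ π′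
Unwinds-determines {n} {π} {π′} {e} {e′} e≈e′ u u′ p = begin
  π ⟨$⟩ʳ p                                    ≡⟨ cong (π ⟨$⟩ʳ_) p≡ ⟩
  π ⟨$⟩ʳ (c ⟨$⟩ʳ i)                           ≡⟨ traces u i ⟩
  c ⟨$⟩ʳ next i                               ≡⟨ e≈e′ _ ⟩
  c′ ⟨$⟩ʳ next i                              ≡⟨ traces u′ i ⟨
  π′ ⟨$⟩ʳ (c′ ⟨$⟩ʳ i)                         ≡⟨ cong (π′ ⟨$⟩ʳ_) (e≈e′ _) ⟨
  π′ ⟨$⟩ʳ (c ⟨$⟩ʳ i)                          ≡⟨ cong (π′ ⟨$⟩ʳ_) p≡ ⟨
  π′ ⟨$⟩ʳ p                                   ∎
  where
  open ≡-Reasoning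
  c  = reflection n 0 ∘ₚ e
  c′ = reflection n 0 ∘ₚ e′
  i  = c ⟨$⟩ˡ p
  p≡ : p ≡ c ⟨$⟩ʳ i
  p≡ = sym (inverseʳ c)

-- Standardization

-- For a relation that is single-valued both ways the round trips come for free: `toCycle` and
-- `fromCycle` need only land in the same relation.
correspondence⇒inverse : (S T : Setoid 0ℓ 0ℓ) → let module S = Setoid S; module T = Setoid T in
  (R : S.Carrier → T.Carrier → Set) →
  (∀ x → ∃[ y ] R x y) → (∀ y → ∃[ x ] R x y) →
  (∀ {x x′ y y′} → x S.≈ x′ → R x y → R x′ y′ → y T.≈ y′) →
  (∀ {x x′ y y′} → y T.≈ y′ → R x y → R x′ y′ → x S.≈ x′) →
  Inverse S T
correspondence⇒inverse S T R total cototal functional injective = record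
  { to        = proj₁ ∘ total
  ; from      = proj₁ ∘ cototal
  ; to-cong   = λ x≈x′ → functional x≈x′ (proj₂ (total _)) (proj₂ (total _))
  ; from-cong = λ y≈y′ → injective y≈y′ (proj₂ (cototal _)) (proj₂ (cototal _))
  ; inverse   = (λ x≈ → functional x≈ (proj₂ (total _)) (proj₂ (cototal _)))
              , (λ y≈ → injective y≈ (proj₂ (cototal _)) (proj₂ (total _)))
  }

-- With `b = block I` and `f` injective this says that all descents of `f` lie in `I`, in a form
-- that also fits the labelling with `∞`.
FibreIncreasing : (Fin N → ℕ) → (Fin N → Fin M) → Set
FibreIncreasing b f = ∀ {p q} → toℕ p < toℕ q → b p ≡ b q → toℕ (f p) < toℕ (f q)

FibreIncreasing-reflects : {b : Fin N → ℕ} {f : Fin N → Fin M} → FibreIncreasing b f →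
  ∀ {p q} → b p ≡ b q → toℕ (f p) < toℕ (f q) → toℕ p < toℕ q
FibreIncreasing-reflects f-inc {p} {q} bp≡bq fp<fq with ℕ.<-cmp (toℕ p) (toℕ q)
... | tri< p<q _ _ = p<q
... | tri≈ _ p≡q _ with refl ← Fin.toℕ-injective p≡q = contradiction fp<fq (ℕ.<-irrefl refl)
... | tri> _ _ q<p = contradiction fp<fq (ℕ.<-asym (f-inc q<p (sym bp≡bq)))

monotone-reflects-< : {b : Fin N → ℕ} → Monotone b → ∀ {p q} → b p < b q → toℕ p < toℕ q
monotone-reflects-< b↗ bp<bq = ℕ.≰⇒> λ q≤p → ℕ.<⇒≱ bp<bq (b↗ q≤p)

punchIn-fromℕ : (i : Fin n) → punchIn (fromℕ n) i ≡ inject₁ i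
punchIn-fromℕ zero    = refl
punchIn-fromℕ (suc i) = cong suc (punchIn-fromℕ i)

-- Lexicographic order on the final segments vₜ₋₁ … v₁ v₀ ∞ (t = 0, …, n) of
-- the word v read from its last letter to its first, where ∞ exceeds all letters.
module LexOrder (v : Fin n → ℕ) where

  data _≺_ : Fin (suc n) → Fin (suc n) → Set where
    end   : ∀ {t} → suc t ≺ zero
    here  : ∀ {t u} → v t < v u → suc t ≺ suc u
    there : ∀ {t u} → v t ≡ v u → inject₁ t ≺ inject₁ u → suc t ≺ suc u

  ≺-trans : ∀ {i j k} → i ≺ j → j ≺ k → i ≺ k
  ≺-trans (here _)    end         = end
  ≺-trans (there _ _) end         = end
  ≺-trans (here p)    (here q)    = here (ℕ.<-trans p q)
  ≺-trans (here p)    (there q _) = here (ℕ.<-≤-trans p (ℕ.≤-reflexive q))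
  ≺-trans (there p _) (here q)    = here (ℕ.≤-<-trans (ℕ.≤-reflexive p) q)
  ≺-trans (there p r) (there q s) = there (trans p q) (≺-trans r s)

  ≺⇒≢ : ∀ {i j} → i ≺ j → i ≢ j
  ≺⇒≢ (here p)    refl = ℕ.<-irrefl refl p
  ≺⇒≢ (there _ r) refl = ≺⇒≢ r refl

  -- Equal letters reduce the comparison to shorter segments. As `∞` closes each segment and occurs
  -- nowhere else, a complete tie forces equal lengths.
  ≺-connex : ∀ i j → i ≺ j ⊎ i ≡ j ⊎ j ≺ i
  ≺-connex = <-weakInduction _ from-zero from-suc
    where
    from-zero : ∀ j → zero ≺ j ⊎ zero ≡ j ⊎ j ≺ zero
    from-zero zero    = inj₂ (inj₁ refl)
    from-zero (suc _) = inj₂ (inj₂ end)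

    from-suc : ∀ t → (∀ j → inject₁ t ≺ j ⊎ inject₁ t ≡ j ⊎ j ≺ inject₁ t) →
               ∀ j → suc t ≺ j ⊎ suc t ≡ j ⊎ j ≺ suc t
    from-suc t ih zero = inj₁ end
    from-suc t ih (suc u) with ℕ.<-cmp (v t) (v u) | ih (inject₁ u)
    ... | tri< lt _ _ | _                = inj₁ (here lt)
    ... | tri> _ _ gt | _                = inj₂ (inj₂ (here gt))
    ... | tri≈ _ eq _ | inj₁ lt          = inj₁ (there eq lt)
    ... | tri≈ _ eq _ | inj₂ (inj₁ same) = inj₂ (inj₁ (cong suc (Fin.inject₁-injective same)))
    ... | tri≈ _ eq _ | inj₂ (inj₂ gt)   = inj₂ (inj₂ (there (sym eq) gt))

  open Sorting _≺_ ≺-trans (λ p → ≺⇒≢ p refl) ≺-connex public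

  -- Segment 0 is `∞` alone and exceeds all others; if another segment held the top place, segment 0
  -- would have to lie above it.
  Sorts⇒start : (e : Permutation′ (suc n)) → Sorts e → e ⟨$⟩ʳ zero ≡ fromℕ n
  Sorts⇒start e e-sorts with e ⟨$⟩ˡ fromℕ n in eq
  ... | zero  = trans (cong (e ⟨$⟩ʳ_) (sym eq)) (inverseʳ e)
  ... | suc t = contradiction
    (subst (λ x → toℕ x < toℕ (e ⟨$⟩ʳ zero))
      (trans (cong (e ⟨$⟩ʳ_) (sym eq)) (inverseʳ e)) (e-sorts end))
    (ℕ.≤⇒≯ (Fin.≤fromℕ (e ⟨$⟩ʳ zero)))

-- The sorting permutation of this order is the standardization of `w`.
module StableOrder (w : Fin N → ℕ) where

  _≺_ : Fin N → Fin N → Set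
  i ≺ j = w i < w j ⊎ (w i ≡ w j × toℕ i < toℕ j)

  ≺-trans : ∀ {i j k} → i ≺ j → j ≺ k → i ≺ k
  ≺-trans (inj₁ p)       (inj₁ q)       = inj₁ (ℕ.<-trans p q)
  ≺-trans (inj₁ p)       (inj₂ (q , _)) = inj₁ (ℕ.<-≤-trans p (ℕ.≤-reflexive q))
  ≺-trans (inj₂ (p , _)) (inj₁ q)       = inj₁ (ℕ.≤-<-trans (ℕ.≤-reflexive p) q)
  ≺-trans (inj₂ (p , r)) (inj₂ (q , s)) = inj₂ (trans p q , ℕ.<-trans r s)

  ≺-irrefl : ∀ {i} → ¬ (i ≺ i)
  ≺-irrefl (inj₁ p)       = ℕ.<-irrefl refl p
  ≺-irrefl (inj₂ (_ , p)) = ℕ.<-irrefl refl p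

  ≺-connex : ∀ i j → i ≺ j ⊎ i ≡ j ⊎ j ≺ i
  ≺-connex i j with ℕ.<-cmp (w i) (w j) | ℕ.<-cmp (toℕ i) (toℕ j)
  ... | tri< lt _ _ | _             = inj₁ (inj₁ lt)
  ... | tri> _ _ gt | _             = inj₂ (inj₂ (inj₁ gt))
  ... | tri≈ _ eq _ | tri< lt _ _   = inj₁ (inj₂ (eq , lt))
  ... | tri≈ _ eq _ | tri≈ _ same _ = inj₂ (inj₁ (Fin.toℕ-injective same))
  ... | tri≈ _ eq _ | tri> _ _ gt   = inj₂ (inj₂ (inj₂ (sym eq , gt)))

  open Sorting _≺_ ≺-trans ≺-irrefl ≺-connex public

-- The bijection between cycles and permutations

module Standardization (b : Fin (suc n) → ℕ) (b↗ : Monotone b)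
  (b-top : ∀ p → b (inject₁ p) < b (fromℕ n)) where

  b↓ : Fin n → ℕ
  b↓ = b ∘ inject₁

  b↓↗ : Monotone b↓
  b↓↗ {i} {j} i≤j = b↗ (subst₂ _≤_ (sym (Fin.toℕ-inject₁ i)) (sym (Fin.toℕ-inject₁ j)) i≤j)

  -- The word of block labels along the cycle π is the one whose standardization is σ.
  Corresponds : Permutation′ n → Permutation′ (suc n) → Set
  Corresponds σ π = ∃[ e ] Unwinds π e × (∀ p → b (e ⟨$⟩ʳ suc (σ ⟨$⟩ʳ p)) ≡ b↓ p)

  letter : {σ : Permutation′ n} {π : Permutation′ (suc n)} ((e , _) : Corresponds σ π) →
           ∀ t → b (e ⟨$⟩ʳ suc t) ≡ b↓ (σ ⟨$⟩ˡ t)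
  letter {σ} (e , _ , word) t = trans (cong (λ x → b (e ⟨$⟩ʳ suc x)) (sym (inverseʳ σ))) (word (σ ⟨$⟩ˡ t))

  -- The inverse of `σ` tells which labels spell the word. The ranks of its segments form `e`, which
  -- is then closed up into a cycle.
  toCycle : (σ : Permutation′ n) →
            ∃[ π ] (IsCycle π × FibreIncreasing b (π ⟨$⟩ʳ_)) × Corresponds σ π
  toCycle σ = π , (Unwinds⇒IsCycle u , increasing) , e , u , word
    where
    open LexOrder (λ t → b↓ (σ ⟨$⟩ˡ t))

    e = proj₁ sorting-exists
    e-sorts = proj₂ sorting-exists
    e₀ = Sorts⇒start e e-sorts

    π = proj₁ (winding e e₀)
    u = proj₂ (winding e e₀)

    -- A rearrangement of the positions along which `b` spells `∞` followed by the word.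
    ρ : Permutation′ (suc n)
    ρ = insert zero (fromℕ n) (flip σ)

    ρ-suc : ∀ t → ρ ⟨$⟩ʳ suc t ≡ inject₁ (σ ⟨$⟩ˡ t)
    ρ-suc t = trans (insert-punchIn zero (fromℕ n) (flip σ) t) (punchIn-fromℕ _)

    bρ-mono : ∀ {i j} → i ≺ j → b (ρ ⟨$⟩ʳ i) ≤ b (ρ ⟨$⟩ʳ j)
    bρ-mono (end {t})           = subst (λ x → b x ≤ b (fromℕ n)) (sym (ρ-suc t)) (ℕ.<⇒≤ (b-top _))
    bρ-mono (here {t} {u} p)    = subst₂ (λ x y → b x ≤ b y) (sym (ρ-suc t)) (sym (ρ-suc u)) (ℕ.<⇒≤ p)
    bρ-mono (there {t} {u} p _) = subst₂ (λ x y → b x ≤ b y) (sym (ρ-suc t)) (sym (ρ-suc u)) (ℕ.≤-reflexive p)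

    be≡ : ∀ t → b (e ⟨$⟩ʳ suc t) ≡ b↓ (σ ⟨$⟩ˡ t)
    be≡ t = trans (sorting-rearranges e e-sorts b↗ ρ bρ-mono (suc t)) (cong b (ρ-suc t))

    word : ∀ p → b (e ⟨$⟩ʳ suc (σ ⟨$⟩ʳ p)) ≡ b↓ p
    word p = trans (be≡ (σ ⟨$⟩ʳ p)) (cong b↓ (inverseˡ σ))

    -- Equal labels leave only `there`, whose premise compares the preceding entries; these are the
    -- images under `π`.
    increasing-along : ∀ {i j} → i ≺ j → b (e ⟨$⟩ʳ i) ≡ b (e ⟨$⟩ʳ j) →
      toℕ (π ⟨$⟩ʳ (e ⟨$⟩ʳ i)) < toℕ (π ⟨$⟩ʳ (e ⟨$⟩ʳ j))
    increasing-along (end {t}) eq = contradiction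
      (trans (sym (be≡ t)) (trans eq (cong b e₀))) (ℕ.<⇒≢ (b-top _))
    increasing-along (here {t} {s} p) eq = contradiction
      (trans (sym (be≡ t)) (trans eq (be≡ s))) (ℕ.<⇒≢ p)
    increasing-along (there {t} {s} _ r) eq =
      subst₂ (λ x y → toℕ x < toℕ y) (sym (step u t)) (sym (step u s)) (e-sorts r)

    increasing : FibreIncreasing b (π ⟨$⟩ʳ_)
    increasing {p} {q} p<q eq =
      subst₂ (λ x y → toℕ (π ⟨$⟩ʳ x) < toℕ (π ⟨$⟩ʳ y)) (inverseʳ e) (inverseʳ e)
        (increasing-along
          (reflects e e-sorts (subst₂ (λ x y → toℕ x < toℕ y) (sym (inverseʳ e)) (sym (inverseʳ e)) p<q))
          (subst₂ (λ x y → b x ≡ b y) (sym (inverseʳ e)) (sym (inverseʳ e)) eq))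

  -- The labels met along the unwinding form the word, and its stable sorting `r` is the inverse of
  -- the required `σ`.
  fromCycle : (π : Permutation′ (suc n)) → IsCycle π →
              ∃[ σ ] FibreIncreasing b↓ (σ ⟨$⟩ʳ_) × Corresponds σ π
  fromCycle π π-cycle = flip r , increasing , e , u , word
    where
    e = proj₁ (unwinding π π-cycle)
    u = proj₂ (unwinding π π-cycle)

    open StableOrder (λ t → b (e ⟨$⟩ʳ suc t))

    r = proj₁ sorting-exists
    r-sorts = proj₂ sorting-exists

    -- `e` starts at the largest element; dropping it leaves a permutation of `n` elements carrying
    -- the same word.
    e↓ : Permutation′ n
    e↓ = remove zero e

    e-suc : ∀ t → e ⟨$⟩ʳ suc t ≡ inject₁ (e↓ ⟨$⟩ʳ t)
    e-suc t = trans (punchIn-permute e zero t)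
      (trans (cong (λ x → punchIn x (e↓ ⟨$⟩ʳ t)) (start u)) (punchIn-fromℕ _))

    mono : ∀ {i j} → i ≺ j → b↓ (e↓ ⟨$⟩ʳ i) ≤ b↓ (e↓ ⟨$⟩ʳ j)
    mono {i} {j} p = subst₂ (λ x y → b x ≤ b y) (e-suc i) (e-suc j) (weaken p)
      where
      weaken : i ≺ j → b (e ⟨$⟩ʳ suc i) ≤ b (e ⟨$⟩ʳ suc j)
      weaken (inj₁ p)       = ℕ.<⇒≤ p
      weaken (inj₂ (p , _)) = ℕ.≤-reflexive p

    word : ∀ p → b (e ⟨$⟩ʳ suc (r ⟨$⟩ˡ p)) ≡ b↓ p
    word p = begin
      b (e ⟨$⟩ʳ suc (r ⟨$⟩ˡ p))    ≡⟨ cong b (e-suc _) ⟩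
      b↓ (e↓ ⟨$⟩ʳ (r ⟨$⟩ˡ p))      ≡⟨ sorting-rearranges r r-sorts b↓↗ e↓ mono _ ⟨
      b↓ (r ⟨$⟩ʳ (r ⟨$⟩ˡ p))       ≡⟨ cong b↓ (inverseʳ r) ⟩
      b↓ p                         ∎
      where open ≡-Reasoning

    increasing : FibreIncreasing b↓ (r ⟨$⟩ˡ_)
    increasing {p} {q} p<q eq
      with reflects r r-sorts (subst₂ (λ x y → toℕ x < toℕ y) (sym (inverseʳ r)) (sym (inverseʳ r)) p<q)
    -- Equal labels mean equal letters, between which the stable order decides by position.
    ... | inj₁ lt       = contradiction (trans (word p) (trans eq (sym (word q)))) (ℕ.<⇒≢ lt)
    ... | inj₂ (_ , lt) = lt

  -- Both unwindings sort the segments of the same word, so they agree, and an unwinding determines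
  -- its cycle.
  cycle-unique : {σ σ′ : Permutation′ n} {π π′ : Permutation′ (suc n)} → σ ≈ σ′ →
    FibreIncreasing b (π ⟨$⟩ʳ_) → FibreIncreasing b (π′ ⟨$⟩ʳ_) →
    Corresponds σ π → Corresponds σ′ π′ → π ≈ π′
  cycle-unique {σ} {σ′} σ≈σ′ π-inc π′-inc c@(e , u , _) (e′ , u′ , word′) =
    Unwinds-determines (sorting-unique e e′ (sorts u π-inc (letter {σ} c))
                                            (sorts u′ π′-inc (letter {σ} c″))) u u′
    where
    c″ : Corresponds σ _
    c″ = e′ , u′ , λ p → trans (cong (λ x → b (e′ ⟨$⟩ʳ suc x)) (σ≈σ′ p)) (word′ p)

    open LexOrder (λ t → b↓ (σ ⟨$⟩ˡ t))

    -- Induction on the comparison: `end` holds as `e` starts at the maximum, `here` as `b` is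
    -- monotone, and `there` as `π` increases on each fibre, so an order between images passes back
    -- to the entries.
    sorts : ∀ {π e} → Unwinds π e → FibreIncreasing b (π ⟨$⟩ʳ_) →
            (∀ t → b (e ⟨$⟩ʳ suc t) ≡ b↓ (σ ⟨$⟩ˡ t)) → Sorts e
    sorts {e = e} u π-inc be≡ (end {t}) = ℕ.≤∧≢⇒<
      (subst (λ x → toℕ (e ⟨$⟩ʳ suc t) ≤ toℕ x) (sym (start u)) (Fin.≤fromℕ _))
      λ eq → contradiction (⟨$⟩ʳ-injective e (Fin.toℕ-injective eq)) λ ()
    sorts u π-inc be≡ (here {t} {s} p) = monotone-reflects-< b↗
      (subst₂ _<_ (sym (be≡ t)) (sym (be≡ s)) p)
    sorts u π-inc be≡ (there {t} {s} p r) = FibreIncreasing-reflects π-inc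
      (trans (be≡ t) (trans p (sym (be≡ s))))
      (subst₂ (λ x y → toℕ x < toℕ y) (sym (step u t)) (sym (step u s)) (sorts u π-inc be≡ r))

  -- Equal cycles have equal unwindings and thus spell the same word, and the inverses of `σ` and
  -- `σ′` both sort it stably.
  standardization-unique : {σ σ′ : Permutation′ n} {π π′ : Permutation′ (suc n)} → π ≈ π′ →
    FibreIncreasing b↓ (σ ⟨$⟩ʳ_) → FibreIncreasing b↓ (σ′ ⟨$⟩ʳ_) →
    Corresponds σ π → Corresponds σ′ π′ → σ ≈ σ′
  standardization-unique {σ} {σ′} π≈π′ σ-inc σ′-inc c@(e , u , _) c′@(e′ , u′ , _) p =
    sym (begin
      σ′ ⟨$⟩ʳ p                      ≡⟨ cong (σ′ ⟨$⟩ʳ_) (inverseˡ σ) ⟨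
      σ′ ⟨$⟩ʳ (σ ⟨$⟩ˡ (σ ⟨$⟩ʳ p))    ≡⟨ cong (σ′ ⟨$⟩ʳ_) (flip≈ (σ ⟨$⟩ʳ p)) ⟩
      σ′ ⟨$⟩ʳ (σ′ ⟨$⟩ˡ (σ ⟨$⟩ʳ p))   ≡⟨ inverseʳ σ′ ⟩
      σ ⟨$⟩ʳ p                       ∎)
    where
    open ≡-Reasoning
    open StableOrder (λ t → b (e ⟨$⟩ʳ suc t))

    sorts : (σ : Permutation′ n) → FibreIncreasing b↓ (σ ⟨$⟩ʳ_) →
            (∀ t → b (e ⟨$⟩ʳ suc t) ≡ b↓ (σ ⟨$⟩ˡ t)) → Sorts (flip σ)
    sorts σ σ-inc be≡ {i} {j} (inj₁ lt) =
      monotone-reflects-< b↓↗ (subst₂ _<_ (be≡ i) (be≡ j) lt)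
    sorts σ σ-inc be≡ {i} {j} (inj₂ (eq , lt)) = FibreIncreasing-reflects σ-inc
      (trans (sym (be≡ i)) (trans eq (be≡ j)))
      (subst₂ (λ x y → toℕ x < toℕ y) (sym (inverseʳ σ)) (sym (inverseʳ σ)) lt)

    flip≈ : flip σ ≈ flip σ′
    flip≈ = sorting-unique (flip σ) (flip σ′) (sorts σ σ-inc (letter {σ} c))
      (sorts σ′ σ′-inc λ t → trans (cong b (Unwinds-unique π≈π′ u u′ (suc t))) (letter {σ′} c′ t))

  standardization : Inverse
    (Perms (suc n) (λ π → IsCycle π × FibreIncreasing b (π ⟨$⟩ʳ_)))
    (Perms n (λ σ → FibreIncreasing b↓ (σ ⟨$⟩ʳ_)))
  standardization = correspondence⇒inverse
    (Perms (suc n) (λ π → IsCycle π × FibreIncreasing b (π ⟨$⟩ʳ_)))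
    (Perms n (λ σ → FibreIncreasing b↓ (σ ⟨$⟩ʳ_)))
    (λ (π , _) (σ , _) → Corresponds σ π)
    (λ (π , π-cycle , _) → let (σ , σ-inc , c) = fromCycle π π-cycle in (σ , σ-inc) , c)
    (λ (σ , _) → let (π , π-ok , c) = toCycle σ in (π , π-ok) , c)
    (λ {_} {_} {(σ , σ-inc)} {(σ′ , σ′-inc)} π≈π′ →
      standardization-unique {σ} {σ′} π≈π′ σ-inc σ′-inc)
    (λ {(π , _ , π-inc)} {(π′ , _ , π′-inc)} {(σ , _)} {(σ′ , _)} σ≈σ′ →
      cycle-unique {σ} {σ′} {π} {π′} σ≈σ′ π-inc π′-inc)

-- Descents and blocks

bit : Bool → ℕ
bit outside = 0
bit inside  = 1

-- The fibres of block I are the maximal runs of positions that may not contain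
-- a descent if the descent set is to be a subset of I.
block : Subset m → Fin (suc m) → ℕ
block I       zero    = 0
block (x ∷ I) (suc p) = bit x + block I p

block-monotone : (I : Subset m) → Monotone (block I)
block-monotone I       {zero}          _         = z≤n
block-monotone (x ∷ I) {suc i} {suc j} (s≤s i≤j) = ℕ.+-monoʳ-≤ (bit x) (block-monotone I i≤j)

block-∷ʳ-inject₁ : (I : Subset m) (x : Bool) (p : Fin (suc m)) → block (I ∷ʳ x) (inject₁ p) ≡ block I p
block-∷ʳ-inject₁ I       x zero    = refl
block-∷ʳ-inject₁ (y ∷ I) x (suc p) = cong (bit y +_) (block-∷ʳ-inject₁ I x p)

block-∷ʳ-fromℕ : (I : Subset m) → block (I ∷ʳ inside) (fromℕ (suc m)) ≡ suc (block I (fromℕ m))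
block-∷ʳ-fromℕ []      = refl
block-∷ʳ-fromℕ (y ∷ I) = trans (cong (bit y +_) (block-∷ʳ-fromℕ I)) (ℕ.+-suc (bit y) _)

-- The appended `inside` opens a new block at the last position, whose label plays the role of `∞`.
block-∷ʳ-top : (I : Subset m) (p : Fin (suc m)) →
               block (I ∷ʳ inside) (inject₁ p) < block (I ∷ʳ inside) (fromℕ (suc m))
block-∷ʳ-top I p = subst₂ _<_ (sym (block-∷ʳ-inject₁ I inside p)) (sym (block-∷ʳ-fromℕ I))
  (s≤s (block-monotone I (Fin.≤fromℕ p)))

block-step : (I : Subset m) (i : Fin m) → lookup I i ≡ outside → block I (inject₁ i) ≡ block I (suc i)
block-step (x ∷ I) zero    refl = refl
block-step (x ∷ I) (suc i) i∉I  = cong (bit x +_) (block-step I i i∉I)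

-- Equal labels at `p < q` mean that `I` has no element from `p` up to `q − 1`, so the ascents in
-- between chain together.
ascents⇒FibreIncreasing : (I : Subset m) (f : Fin (suc m) → Fin N) →
  (∀ i → lookup I i ≡ outside → toℕ (f (inject₁ i)) < toℕ (f (suc i))) →
  FibreIncreasing (block I) f
ascents⇒FibreIncreasing (x ∷ I) f asc {suc p} {suc q} (s≤s p<q) eq =
  ascents⇒FibreIncreasing I (f ∘ suc) (asc ∘ suc) p<q (ℕ.+-cancelˡ-≡ (bit x) _ _ eq)
-- After a leading `inside` no later position has label 0, so only `outside` remains. Then position
-- 1 has label 0 too, and `eq` serves for the tail as well.
ascents⇒FibreIncreasing (outside ∷ I) f asc {zero} {suc zero} _ eq = asc zero refl
ascents⇒FibreIncreasing (outside ∷ I) f asc {zero} {suc (suc q)} _ eq =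
  ℕ.<-trans (asc zero refl) (ascents⇒FibreIncreasing I (f ∘ suc) (asc ∘ suc) {zero} {suc q} (s≤s z≤n) eq)

descent? : (f : Fin (suc m) → Fin N) → Decidable (λ i → toℕ (f (suc i)) < toℕ (f (inject₁ i)))
descent? f i = f (suc i) Fin.<? f (inject₁ i)

-- The free codomain covers both `σ` and the first `n` values of `π`; on a permutation this unfolds
-- to the same term as `D`.
descents : (Fin (suc m) → Fin N) → Subset m
descents f = comprehension (descent? f)

descents-cong : {f g : Fin (suc m) → Fin N} → (∀ i → f i ≡ g i) → descents f ≡ descents g
descents-cong f≗g = tabulate-cong λ i →
  cong₂ (λ x y → does (x Fin.<? y)) (f≗g (suc i)) (f≗g (inject₁ i))

descents⊆⇒FibreIncreasing : {f : Fin (suc m) → Fin N} → Injective _≡_ _≡_ f → {I : Subset m} →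
  descents f ⊆ I → FibreIncreasing (block I) f
descents⊆⇒FibreIncreasing {f = f} f-inj {I} D⊆I = ascents⇒FibreIncreasing I f ascent
  where
  ascent : ∀ i → lookup I i ≡ outside → toℕ (f (inject₁ i)) < toℕ (f (suc i))
  ascent i i∉I = ℕ.≤∧≢⇒<
    (ℕ.≮⇒≥ λ desc → contradiction
      (trans (sym ([]=⇒lookup (D⊆I (∈-comprehension⁺ (descent? f) desc)))) i∉I) λ ())
    λ same → ℕ.1+n≢n (sym (trans (sym (Fin.toℕ-inject₁ i)) (cong toℕ (f-inj (Fin.toℕ-injective same)))))

FibreIncreasing⇒descents⊆ : (f : Fin (suc m) → Fin N) {I : Subset m} →
  FibreIncreasing (block I) f → descents f ⊆ I
FibreIncreasing⇒descents⊆ f {I} f-inc {i} i∈D with lookup I i in eq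
... | inside  = lookup⇒[]= i I eq
... | outside = contradiction (∈-comprehension⁻ (descent? f) i∈D)
  (ℕ.<-asym (f-inc (s≤s (ℕ.≤-reflexive (Fin.toℕ-inject₁ i))) (block-step I i eq)))

module _ (b : Fin (suc n) → ℕ) (b-top : ∀ p → b (inject₁ p) < b (fromℕ n)) (f : Fin (suc n) → Fin N) where

  -- The last position is alone in its fibre and adds no condition, which is why a descent at `n`
  -- stays free.
  FibreIncreasing-extend : FibreIncreasing (b ∘ inject₁) (f ∘ inject₁) → FibreIncreasing b f
  FibreIncreasing-extend f-inc {p} {q} p<q eq with view p | view q
  ... | ‵fromℕ      | _           = contradiction p<q (ℕ.≤⇒≯ (Fin.≤fromℕ q))
  ... | ‵inject₁ p′ | ‵fromℕ      = contradiction eq (ℕ.<⇒≢ (b-top p′))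
  ... | ‵inject₁ p′ | ‵inject₁ q′ =
    f-inc (subst₂ _<_ (Fin.toℕ-inject₁ p′) (Fin.toℕ-inject₁ q′) p<q) eq

  FibreIncreasing-restrict : FibreIncreasing b f → FibreIncreasing (b ∘ inject₁) (f ∘ inject₁)
  FibreIncreasing-restrict f-inc {p} {q} p<q =
    f-inc (subst₂ _<_ (sym (Fin.toℕ-inject₁ p)) (sym (Fin.toℕ-inject₁ q)) p<q)

FibreIncreasing-cong : {b c : Fin N → ℕ} → (∀ p → b p ≡ c p) → (f : Fin N → Fin M) →
  FibreIncreasing b f → FibreIncreasing c f
FibreIncreasing-cong b≗c f f-inc {p} {q} p<q eq = f-inc p<q (trans (b≗c p) (trans eq (sym (b≗c q))))

tabulate-∷ʳ : {A : Set} (f : Fin (suc n) → A) → tabulate f ≡ tabulate (f ∘ inject₁) ∷ʳ f (fromℕ n)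
tabulate-∷ʳ {zero}  f = refl
tabulate-∷ʳ {suc n} f = cong (f zero ∷_) (tabulate-∷ʳ (f ∘ suc))

∷ʳ-∩-ι⊤ : (p : Subset m) (x : Bool) → (p ∷ʳ x) ∩ ι ⊤ ≡ ι p
∷ʳ-∩-ι⊤ []      x = cong (_∷ []) (Bool.∧-zeroʳ x)
∷ʳ-∩-ι⊤ (y ∷ p) x = cong₂ _∷_ (Bool.∧-identityʳ y) (∷ʳ-∩-ι⊤ p x)

initialDescents : Permutation′ (suc (suc m)) → Subset m
initialDescents π = descents ((π ⟨$⟩ʳ_) ∘ inject₁)

D∩ι⊤ : (π : Permutation′ (suc (suc m))) → D π ∩ ι ⊤ ≡ ι (initialDescents π)
D∩ι⊤ π = trans (cong (_∩ ι ⊤) (tabulate-∷ʳ (λ i → does (π ⟨$⟩ʳ suc i Fin.<? π ⟨$⟩ʳ inject₁ i))))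
  (∷ʳ-∩-ι⊤ (initialDescents π) _)

-- Counting by inclusion of subsets

infixl 5 _↾_
-- `Perms n P` unfolds to `Sym n ↾ P`, so conditions can be split off one after another.
_↾_ : (S : Setoid 0ℓ 0ℓ) → (Setoid.Carrier S → Set) → Setoid 0ℓ 0ℓ
S ↾ P = On.setoid {B = Σ (Setoid.Carrier S) P} S proj₁

module _ (S : Setoid 0ℓ 0ℓ) where
  open Setoid S using (Carrier)

  ↾-⇔ : {P Q : Carrier → Set} → (∀ x → P x → Q x) → (∀ x → Q x → P x) → Inverse (S ↾ P) (S ↾ Q)
  ↾-⇔ P⇒Q Q⇒P = record
    { to = λ (x , p) → x , P⇒Q x p ; from = λ (x , q) → x , Q⇒P x q
    ; to-cong = λ eq → eq ; from-cong = λ eq → eq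
    ; inverse = (λ eq → eq) , (λ eq → eq) }

  ↾-× : {P Q : Carrier → Set} → Inverse (S ↾ (λ x → P x × Q x)) (S ↾ P ↾ (Q ∘ proj₁))
  ↾-× = record
    { to = λ (x , p , q) → (x , p) , q ; from = λ ((x , p) , q) → x , p , q
    ; to-cong = λ eq → eq ; from-cong = λ eq → eq
    ; inverse = (λ eq → eq) , (λ eq → eq) }

  ↾-universal : {P : Carrier → Set} → (∀ x → P x) → Inverse S (S ↾ P)
  ↾-universal p = record
    { to = λ x → x , p x ; from = proj₁
    ; to-cong = λ eq → eq ; from-cong = λ eq → eq
    ; inverse = (λ eq → eq) , (λ eq → eq) }

HasSize-unique : {S T : Setoid 0ℓ 0ℓ} {k l : ℕ} → Inverse S T → S HasSize k → T HasSize l → k ≡ l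
HasSize-unique S≅T S≅k T≅l = ↔⇒≡ (≅-trans (≅-sym S≅k) (≅-trans S≅T T≅l))

Subset-HasSize : (p : Subset N) → setoid (Fin N) ↾ (_∈ p) HasSize ∣ p ∣
Subset-HasSize p = record
  { to = to p ; from = from p
  ; to-cong = λ {x} {y} → to-cong p x y ; from-cong = λ { refl → refl }
  ; inverse = (λ {x} {y} eq → trans (to-cong p y (from p x) eq) (to-from p x)) , λ { {x} refl → from-to p x } }
  where
  to : (p : Subset N) → Σ (Fin N) (_∈ p) → Fin ∣ p ∣
  to (inside  ∷ p) (zero  , here)    = zero
  to (inside  ∷ p) (suc i , there m) = suc (to p (i , m))
  to (outside ∷ p) (suc i , there m) = to p (i , m)

  from : (p : Subset N) → Fin ∣ p ∣ → Σ (Fin N) (_∈ p)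
  from (inside  ∷ p) zero    = zero , here
  from (inside  ∷ p) (suc k) = suc (proj₁ (from p k)) , there (proj₂ (from p k))
  from (outside ∷ p) k       = suc (proj₁ (from p k)) , there (proj₂ (from p k))

  to-cong : (p : Subset N) (x y : Σ (Fin N) (_∈ p)) → proj₁ x ≡ proj₁ y → to p x ≡ to p y
  to-cong (inside  ∷ p) (zero  , here)    (zero  , here)    _    = refl
  to-cong (inside  ∷ p) (suc i , there m) (suc i , there l) refl = cong suc (to-cong p (i , m) (i , l) refl)
  to-cong (outside ∷ p) (suc i , there m) (suc i , there l) refl = to-cong p (i , m) (i , l) refl

  to-from : (p : Subset N) (k : Fin ∣ p ∣) → to p (from p k) ≡ k
  to-from (inside  ∷ p) zero    = refl
  to-from (inside  ∷ p) (suc k) = cong suc (to-from p k)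
  to-from (outside ∷ p) k       = to-from p k

  from-to : (p : Subset N) (x : Σ (Fin N) (_∈ p)) → proj₁ (from p (to p x)) ≡ proj₁ x
  from-to (inside  ∷ p) (zero  , here)    = refl
  from-to (inside  ∷ p) (suc i , there m) = cong suc (from-to p (i , m))
  from-to (outside ∷ p) (suc i , there m) = cong suc (from-to p (i , m))

module _ {S : Setoid 0ℓ 0ℓ} (S≅N : S HasSize N) where
  open Setoid S using (Carrier) renaming (_≈_ to _~_)
  private module E = Inverse S≅N

  select : {P : Carrier → Set} → Decidable P → Subset N
  select P? = comprehension (P? ∘ E.from)

  ↾-HasSize : {P : Carrier → Set} (P? : Decidable P) → (∀ {x y} → x ~ y → P x → P y) →
              S ↾ P HasSize ∣ select P? ∣
  ↾-HasSize {P} P? P-resp = ≅-trans S↾P≅ (Subset-HasSize (select P?))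
    where
    S↾P≅ : Inverse (S ↾ P) (setoid (Fin N) ↾ (_∈ select P?))
    S↾P≅ = record
      { to   = λ (x , p) → E.to x , ∈-comprehension⁺ (P? ∘ E.from) (P-resp (Setoid.sym S (E.inverseʳ refl)) p)
      ; from = λ (i , i∈) → E.from i , ∈-comprehension⁻ (P? ∘ E.from) i∈
      ; to-cong = E.to-cong ; from-cong = E.from-cong
      ; inverse = E.inverseˡ , E.inverseʳ }

-- Möbius inversion over subsets

-- The zeta transform of the Boolean lattice, summing `f` over all `J ⊆ I`.
zeta : (Subset m → ℕ) → Subset m → ℕ
zeta f []            = f []
zeta f (outside ∷ I) = zeta (f ∘ (outside ∷_)) I
zeta f (inside  ∷ I) = zeta (f ∘ (outside ∷_)) I + zeta (f ∘ (inside ∷_)) I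

zeta-cong : {f g : Subset m → ℕ} → (∀ J → f J ≡ g J) → ∀ I → zeta f I ≡ zeta g I
zeta-cong f≗g []            = f≗g []
zeta-cong f≗g (outside ∷ I) = zeta-cong (f≗g ∘ (outside ∷_)) I
zeta-cong f≗g (inside  ∷ I) = cong₂ _+_ (zeta-cong (f≗g ∘ (outside ∷_)) I) (zeta-cong (f≗g ∘ (inside ∷_)) I)

zeta-0 : (I : Subset m) → zeta (λ _ → 0) I ≡ 0
zeta-0 []            = refl
zeta-0 (outside ∷ I) = zeta-0 I
zeta-0 (inside  ∷ I) = cong₂ _+_ (zeta-0 I) (zeta-0 I)

zeta-+ : (f g : Subset m → ℕ) (I : Subset m) → zeta (λ J → f J + g J) I ≡ zeta f I + zeta g I
zeta-+ f g []            = refl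
zeta-+ f g (outside ∷ I) = zeta-+ (f ∘ (outside ∷_)) (g ∘ (outside ∷_)) I
zeta-+ f g (inside  ∷ I) = trans
  (cong₂ _+_ (zeta-+ (f ∘ (outside ∷_)) (g ∘ (outside ∷_)) I) (zeta-+ (f ∘ (inside ∷_)) (g ∘ (inside ∷_)) I))
  (interchange ℕ.+-commutativeSemigroup (zeta (f ∘ (outside ∷_)) I) _ _ _)

-- Möbius inversion one coordinate at a time: cancelling the transform at `outside ∷ J` from the one
-- at `inside ∷ J` leaves the transform of `f ∘ (inside ∷_)`.
zeta-injective : {f g : Subset m → ℕ} → (∀ I → zeta f I ≡ zeta g I) → ∀ I → f I ≡ g I
zeta-injective eq []            = eq []
zeta-injective eq (outside ∷ I) = zeta-injective (eq ∘ (outside ∷_)) I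
zeta-injective {f = f} {g} eq (inside ∷ I) = zeta-injective (λ J → ℕ.+-cancelˡ-≡ (zeta (f ∘ (outside ∷_)) J) _ _
  (trans (eq (inside ∷ J)) (cong (_+ zeta (g ∘ (inside ∷_)) J) (sym (eq (outside ∷ J)))))) I

_≟ˢ_ : DecidableEquality (Subset m)
_≟ˢ_ = ≡-dec Bool._≟_

zeta-indicator : (K I : Subset m) → zeta (λ J → bit (does (K ≟ˢ J))) I ≡ bit (does (K ⊆? I))
zeta-indicator []            []            = refl
zeta-indicator (outside ∷ K) (outside ∷ I) = zeta-indicator K I
zeta-indicator (inside  ∷ K) (outside ∷ I) = zeta-0 I
zeta-indicator (outside ∷ K) (inside  ∷ I) =
  trans (cong₂ _+_ (zeta-indicator K I) (zeta-0 I)) (ℕ.+-identityʳ _)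
zeta-indicator (inside  ∷ K) (inside  ∷ I) = cong₂ _+_ (zeta-0 I) (zeta-indicator K I)

∣∷∣ : (x : Bool) (p : Subset n) → ∣ x ∷ p ∣ ≡ bit x + ∣ p ∣
∣∷∣ outside p = refl
∣∷∣ inside  p = refl

-- Exchange of summation: each `i` is counted for the single set `J = δ i`, and this `J` is in the
-- sum exactly if `δ i ⊆ I`.
zeta-count : (δ : Fin N → Subset m) (I : Subset m) →
  zeta (λ J → ∣ comprehension (λ i → δ i ≟ˢ J) ∣) I ≡ ∣ comprehension (λ i → δ i ⊆? I) ∣
zeta-count {zero}  δ I = zeta-0 I
zeta-count {suc N} δ I = begin
  zeta (λ J → ∣ comprehension (λ i → δ i ≟ˢ J) ∣) I
    ≡⟨ zeta-cong (λ J → ∣∷∣ (does (δ zero ≟ˢ J)) (comprehension λ i → δ (suc i) ≟ˢ J)) I ⟩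
  zeta (λ J → bit (does (δ zero ≟ˢ J)) + ∣ comprehension (λ i → δ (suc i) ≟ˢ J) ∣) I
    ≡⟨ zeta-+ (λ J → bit (does (δ zero ≟ˢ J))) _ I ⟩
  zeta (λ J → bit (does (δ zero ≟ˢ J))) I + zeta (λ J → ∣ comprehension (λ i → δ (suc i) ≟ˢ J) ∣) I
    ≡⟨ cong₂ _+_ (zeta-indicator (δ zero) I) (zeta-count (δ ∘ suc) I) ⟩
  bit (does (δ zero ⊆? I)) + ∣ comprehension (λ i → δ (suc i) ⊆? I) ∣
    ≡⟨ ∣∷∣ (does (δ zero ⊆? I)) (comprehension λ i → δ (suc i) ⊆? I) ⟨
  ∣ comprehension (λ i → δ i ⊆? I) ∣ ∎
  where open ≡-Reasoning

equidistribution : (S T : Setoid 0ℓ 0ℓ) → let module S = Setoid S; module T = Setoid T in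
  T HasSize N →
  (d : S.Carrier → Subset m) → (∀ {x y} → x S.≈ y → d x ≡ d y) →
  (d′ : T.Carrier → Subset m) → (∀ {x y} → x T.≈ y → d′ x ≡ d′ y) →
  (∀ I → Inverse (S ↾ (λ x → d x ⊆ I)) (T ↾ (λ y → d′ y ⊆ I))) →
  ∀ I → ∃[ k ] S ↾ (λ x → d x ≡ I) HasSize k × T ↾ (λ y → d′ y ≡ I) HasSize k
equidistribution {N} {m} S T T≅N d d-cong d′ d′-cong cumulative I =
  count≡ S≅N d I , ≡-size S S≅N d d-cong I , subst (_ HasSize_) (sym (counts-agree I)) (≡-size T T≅N d′ d′-cong I)
  where
  module S = Setoid S
  module T = Setoid T

  -- Every set lies in `⊤`, so the bijection at `⊤` is one between all of `S` and all of `T`.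
  S≅N : S HasSize N
  S≅N = ≅-trans (↾-universal S {λ x → d x ⊆ ⊤} (λ _ → ⊆⊤)) (≅-trans (cumulative ⊤)
    (≅-trans (≅-sym (↾-universal T {λ y → d′ y ⊆ ⊤} (λ _ → ⊆⊤))) T≅N))

  count≡ : {U : Setoid 0ℓ 0ℓ} → U HasSize N → (Setoid.Carrier U → Subset m) → Subset m → ℕ
  count≡ U≅N d J = ∣ select U≅N (λ x → d x ≟ˢ J) ∣

  ≡-size : (U : Setoid 0ℓ 0ℓ) (U≅N : U HasSize N) (d : Setoid.Carrier U → Subset m) →
    (∀ {x y} → Setoid._≈_ U x y → d x ≡ d y) → ∀ J → U ↾ (λ x → d x ≡ J) HasSize count≡ U≅N d J
  ≡-size U U≅N d d-cong J = ↾-HasSize U≅N (λ x → d x ≟ˢ J) (λ x≈y → trans (sym (d-cong x≈y)))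

  ⊆-size : (U : Setoid 0ℓ 0ℓ) (U≅N : U HasSize N) (d : Setoid.Carrier U → Subset m) →
    (∀ {x y} → Setoid._≈_ U x y → d x ≡ d y) → ∀ J → U ↾ (λ x → d x ⊆ J) HasSize zeta (count≡ U≅N d) J
  ⊆-size U U≅N d d-cong J = subst (_ HasSize_) (sym (zeta-count (d ∘ Inverse.from U≅N) J))
    (↾-HasSize U≅N (λ x → d x ⊆? J) (λ x≈y → subst (_⊆ J) (d-cong x≈y)))

  counts-agree : ∀ J → count≡ S≅N d J ≡ count≡ T≅N d′ J
  counts-agree = zeta-injective λ J →
    HasSize-unique (cumulative J) (⊆-size S S≅N d d-cong J) (⊆-size T T≅N d′ d′-cong J)

-- Finiteness of the symmetric groups

funToFin-cong : {f g : Fin m → Fin n} → (∀ i → f i ≡ g i) → funToFin f ≡ funToFin g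
funToFin-cong {zero}  f≗g = refl
funToFin-cong {suc m} f≗g = cong₂ combine (f≗g zero) (funToFin-cong (f≗g ∘ suc))

-- A permutation is determined by its table of values, coded by a number below `n ^ n`; the tables
-- that occur are the injective ones, a decidable condition.
Sym-finite : (n : ℕ) → ∃[ N ] Sym n HasSize N
Sym-finite n = _ , ≅-trans Sym≅ (↾-HasSize (≅-refl (setoid (Fin (n ^ n)))) isPerm? (λ { refl p → p }))
  where
  IsPerm : Fin (n ^ n) → Set
  IsPerm x = Σ (Permutation′ n) λ π → ∀ i → π ⟨$⟩ʳ i ≡ finToFun x i

  isPerm? : Decidable IsPerm
  isPerm? x = map′
    (λ inj → fromInjective (finToFun x) (inj _ _) , λ _ → refl)
    (λ (π , π≡) i j eq → ⟨$⟩ʳ-injective π (trans (π≡ i) (trans eq (sym (π≡ j)))))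
    (Fin.all? λ i → Fin.all? λ j → (finToFun x i Fin.≟ finToFun x j) →-dec (i Fin.≟ j))

  Sym≅ : Inverse (Sym n) (setoid (Fin (n ^ n)) ↾ IsPerm)
  Sym≅ = correspondence⇒inverse (Sym n) (setoid (Fin (n ^ n)) ↾ IsPerm)
    (λ π (x , _) → ∀ i → π ⟨$⟩ʳ i ≡ finToFun x i)
    (λ π → let π≡ = λ i → sym (Fin.finToFun-funToFin (π ⟨$⟩ʳ_) i) in (funToFin (π ⟨$⟩ʳ_) , π , π≡) , π≡)
    (λ (x , π , π≡) → π , π≡)
    (λ {_} {_} {(x , _)} {(y , _)} π≈π′ π≡ π′≡ → begin
      x                          ≡⟨ Fin.funToFin-finToFin {n} {n} x ⟨
      funToFin {n} (finToFun x)  ≡⟨ funToFin-cong {n} (λ i → trans (sym (π≡ i)) (trans (π≈π′ i) (π′≡ i))) ⟩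
      funToFin {n} (finToFun y)  ≡⟨ Fin.funToFin-finToFin {n} {n} y ⟩
      y                          ∎)
    (λ { refl π≡ π′≡ i → trans (π≡ i) (sym (π′≡ i)) })
    where open ≡-Reasoning

corollary4p1 : (m : ℕ) (I : Subset m) → let n = suc m in
    ∃[ k ] Perms (suc n) (λ π → IsCycle π × D π ∩ ι ⊤ ≡ ι I) HasSize k
    × Perms n (λ σ → D σ ≡ I) HasSize k
corollary4p1 m I =
  let k , cycles , perms = equidistribution Cycles (Sym (suc m)) (proj₂ (Sym-finite (suc m)))
        (initialDescents ∘ proj₁) (λ π≈π′ → descents-cong (π≈π′ ∘ inject₁))
        D descents-cong cumulative I
  in k , ≅-trans (↾-⇔ (Sym (suc (suc m))) to-initial from-initial)
           (≅-trans (↾-× (Sym (suc (suc m)))) cycles) , perms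
  where
  Cycles : Setoid 0ℓ 0ℓ
  Cycles = Perms (suc (suc m)) IsCycle

  to-initial : ∀ π → IsCycle π × D π ∩ ι ⊤ ≡ ι I → IsCycle π × initialDescents π ≡ I
  to-initial π (c , eq) = c , ∷ʳ-injectiveˡ _ _ (trans (sym (D∩ι⊤ π)) eq)

  from-initial : ∀ π → IsCycle π × initialDescents π ≡ I → IsCycle π × D π ∩ ι ⊤ ≡ ι I
  from-initial π (c , eq) = c , trans (D∩ι⊤ π) (cong ι eq)

  -- Both inclusions of descent sets are restated as monotonicity on the blocks of `J`, where
  -- `standardization` applies.
  cumulative : ∀ J → Inverse (Cycles ↾ (λ (π , _) → initialDescents π ⊆ J)) (Sym (suc m) ↾ (λ σ → D σ ⊆ J))
  cumulative J = ≅-trans (≅-sym (↾-× (Sym (suc (suc m))))) (≅-trans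
    (↾-⇔ (Sym (suc (suc m))) descents⊆⇒increasing increasing⇒descents⊆)
    (≅-trans standardization (↾-⇔ (Sym (suc m)) increasing⇒D⊆ D⊆⇒increasing)))
    where
    b : Fin (suc (suc m)) → ℕ
    -- The extra `inside` separates position `n + 1` from the blocks of `J`.
    b = block (J ∷ʳ inside)

    open Standardization b (block-monotone (J ∷ʳ inside)) (block-∷ʳ-top J)

    b↓≗ : ∀ p → b↓ p ≡ block J p
    b↓≗ = block-∷ʳ-inject₁ J inside

    descents⊆⇒increasing : ∀ π → IsCycle π × initialDescents π ⊆ J → IsCycle π × FibreIncreasing b (π ⟨$⟩ʳ_)
    descents⊆⇒increasing π (c , D⊆J) = c , FibreIncreasing-extend b (block-∷ʳ-top J) (π ⟨$⟩ʳ_)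
      (FibreIncreasing-cong (sym ∘ b↓≗) ((π ⟨$⟩ʳ_) ∘ inject₁)
        (descents⊆⇒FibreIncreasing (Fin.inject₁-injective ∘ ⟨$⟩ʳ-injective π) D⊆J))

    increasing⇒descents⊆ : ∀ π → IsCycle π × FibreIncreasing b (π ⟨$⟩ʳ_) → IsCycle π × initialDescents π ⊆ J
    increasing⇒descents⊆ π (c , π-inc) = c , FibreIncreasing⇒descents⊆ ((π ⟨$⟩ʳ_) ∘ inject₁)
      (FibreIncreasing-cong b↓≗ ((π ⟨$⟩ʳ_) ∘ inject₁)
        (FibreIncreasing-restrict b (block-∷ʳ-top J) (π ⟨$⟩ʳ_) π-inc))

    increasing⇒D⊆ : (σ : Permutation′ (suc m)) → FibreIncreasing b↓ (σ ⟨$⟩ʳ_) → D σ ⊆ J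
    increasing⇒D⊆ σ σ-inc = FibreIncreasing⇒descents⊆ (σ ⟨$⟩ʳ_) (FibreIncreasing-cong b↓≗ (σ ⟨$⟩ʳ_) σ-inc)

    D⊆⇒increasing : (σ : Permutation′ (suc m)) → D σ ⊆ J → FibreIncreasing b↓ (σ ⟨$⟩ʳ_)
    D⊆⇒increasing σ D⊆J = FibreIncreasing-cong (sym ∘ b↓≗) (σ ⟨$⟩ʳ_)
      (descents⊆⇒FibreIncreasing (⟨$⟩ʳ-injective σ) D⊆J)
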